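{- Let $G$ be a finite simple graph with no isolated vertices that is not isomorphic to any of the following graphs, each built on a path $P$ with vertices $r,s,t,u$ and edges $rs,st,tu$: (1) $P$ plus a vertex adjacent exactly to $r$ and $u$ (i.e. $C_5$); (2) $P$ plus a vertex adjacent exactly to $r,s,u$; (3) $P$ plus a vertex $v$ adjacent exactly to $r,s,u$ and a vertex $w$ adjacent exactly to $r,t,u$, with $v,w$ nonadjacent; (4) for any integer $k\ge 0$: $P$ plus $k$ pairwise nonadjacent vertices, each adjacent exactly to $r$ and $t$; (5) for any integer $k\ge 0$: $P$ plus $k$ pairwise nonadjacent vertices, each adjacent exactly to $r,s,t,u$. Then $G$ is $P_4$-free if and only if $G/e$ is $P_4$-free for every edge $e\in E(G)$.
   Context: All graphs are finite and simple. $P_4$ is the path on four vertices. A graph is $H$-free if it has no induced subgraph isomorphic to $H$. For an edge $e=uv$ of $G$, the contraction $G/e$ is obtained from $G$ by deleting $u$ and $v$ and adding a new vertex adjacent to every vertex of $(N(u)\cup N(v))\setminus\{u,v\}$. -}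

module Defs where

open import Data.Nat using (ℕ; zero; suc; _+_; _≡ᵇ_; _<ᵇ_)
open import Data.Fin using (Fin; toℕ; punchIn)
open import Data.Fin.Properties using (_≟_)
open import Data.Bool using (Bool; true; false; _∨_; _∧_; not; if_then_else_)
open import Data.Product using (Σ; ∃; _×_; _,_)
open import Relation.Binary.PropositionalEquality using (_≡_; _≢_)
open import Relation.Nullary using (¬_; does)
open import Data.Unit using (⊤)
open import Function.Bundles using (_↔_; Inverse)

Graph : ℕ → Set
Graph n = Fin n → Fin n → Bool

Simple : ∀ {n} → Graph n → Set
Simple {n} G = (∀ (i j : Fin n) → G i j ≡ G j i) × (∀ (i : Fin n) → G i i ≡ false)

NoIsolatedVertices : ∀ {n} → Graph n → Set
NoIsolatedVertices {n} G = ∀ (i : Fin n) → ∃ λ (j : Fin n) → G i j ≡ true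

_≅_ : ∀ {n m} → Graph n → Graph m → Set
_≅_ {n} {m} G H =
  Σ (Fin n ↔ Fin m) λ f → ∀ (i j : Fin n) → G i j ≡ H (Inverse.to f i) (Inverse.to f j)

InducedP4 : ∀ {n} → Graph n → Set
InducedP4 {n} G = Σ (Fin n) λ a → Σ (Fin n) λ b → Σ (Fin n) λ c → Σ (Fin n) λ d →
  (a ≢ b × a ≢ c × a ≢ d × b ≢ c × b ≢ d × c ≢ d) ×
  (G a b ≡ true × G b c ≡ true × G c d ≡ true) ×
  (G a c ≡ false × G a d ≡ false × G b d ≡ false)

P4Free : ∀ {n} → Graph n → Set
P4Free G = ¬ InducedP4 G

-- Contraction G/e of the edge e = uv of a graph on Fin (suc m).
-- The vertices of G/e are indexed by Fin m via i ↦ punchIn v i (i.e. all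
-- vertices of G other than v); the vertex u plays the role of the new vertex,
-- which is adjacent to every vertex of (N(u) ∪ N(v)) ∖ {u,v}.
contract : ∀ {m} → Graph (suc m) → Fin (suc m) → Fin (suc m) → Graph m
contract G u v i j =
  if does (i ≟ j) then false
  else (if does (a ≟ u) then (G u b ∨ G v b)
  else (if does (b ≟ u) then (G u a ∨ G v a)
  else G a b))
  where
  a = punchIn v i
  b = punchIn v j

AllContractionsP4Free : ∀ {n} → Graph n → Set
AllContractionsP4Free {zero} G = ⊤
AllContractionsP4Free {suc m} G =
  ∀ (u v : Fin (suc m)) → G u v ≡ true → P4Free (contract G u v)

-- Exceptional graphs. Path P: r = 0, s = 1, t = 2, u = 3; extra vertices 4, 5, ...
sym-graph : ∀ {n} → (ℕ → ℕ → Bool) → Graph n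
sym-graph E i j = E (toℕ i) (toℕ j) ∨ E (toℕ j) (toℕ i)

pathE : ℕ → ℕ → Bool
pathE x y = ((x ≡ᵇ 0) ∧ (y ≡ᵇ 1)) ∨ ((x ≡ᵇ 1) ∧ (y ≡ᵇ 2)) ∨ ((x ≡ᵇ 2) ∧ (y ≡ᵇ 3))

ex1 : Graph 5
ex1 = sym-graph λ x y → pathE x y ∨ ((x ≡ᵇ 4) ∧ ((y ≡ᵇ 0) ∨ (y ≡ᵇ 3)))

ex2 : Graph 5
ex2 = sym-graph λ x y → pathE x y ∨ ((x ≡ᵇ 4) ∧ ((y ≡ᵇ 0) ∨ (y ≡ᵇ 1) ∨ (y ≡ᵇ 3)))

ex3 : Graph 6
ex3 = sym-graph λ x y → pathE x y
  ∨ ((x ≡ᵇ 4) ∧ ((y ≡ᵇ 0) ∨ (y ≡ᵇ 1) ∨ (y ≡ᵇ 3)))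
  ∨ ((x ≡ᵇ 5) ∧ ((y ≡ᵇ 0) ∨ (y ≡ᵇ 2) ∨ (y ≡ᵇ 3)))

ex4 : (k : ℕ) → Graph (4 + k)
ex4 k = sym-graph λ x y → pathE x y ∨ ((3 <ᵇ x) ∧ ((y ≡ᵇ 0) ∨ (y ≡ᵇ 2)))

ex5 : (k : ℕ) → Graph (4 + k)
ex5 k = sym-graph λ x y → pathE x y ∨ ((3 <ᵇ x) ∧ (y <ᵇ 4))

NotExceptional : ∀ {n} → Graph n → Set
NotExceptional G =
  ¬ (G ≅ ex1) × ¬ (G ≅ ex2) × ¬ (G ≅ ex3) ×
  (∀ (k : ℕ) → ¬ (G ≅ ex4 k)) × (∀ (k : ℕ) → ¬ (G ≅ ex5 k))

{-# OPTIONS --safe #-}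
module Submission where

-- If all contractions are P₄-free and P is an induced P₄, then contracting an edge outside P
-- shows that the vertices outside P are independent, and contracting an edge between P and an
-- outside vertex x leaves only six possible neighbourhoods of x on P. For two outside vertices
-- the same argument leaves five ordered pairs of neighbourhoods, found by a finite search; each
-- of rt, su, rstu pairs only with itself, rsu only with rtu, and ru with nothing.

open import Defs
open import Data.Bool using (Bool; true; false; _∨_)
import Data.Bool.Properties as Bool
open import Data.Fin using (Fin; zero; suc; punchIn; punchOut; _↑ˡ_; _↑ʳ_; splitAt; join; opposite)
open import Data.Fin.Patterns using (0F; 1F; 2F; 3F; 4F)
open import Data.Fin.Permutation as Perm
  using (Permutation; _⟨$⟩ʳ_; _⟨$⟩ˡ_; inverseʳ; inverseˡ; _∘ₚ_; transpose; insert)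
open import Data.Fin.Properties
  using (_≟_; any?; all?; suc-injective; punchInᵢ≢i; punchIn-injective; punchIn-punchOut
        ; punchOut-injective; join-splitAt; splitAt-↑ˡ; splitAt-↑ʳ; ↑ʳ-injective)
open import Data.Fin.Subset using (Subset; inside; outside) renaming (⊥ to ∅)
open import Data.Fin.Subset.Properties using (anySubset?)
open import Data.List using (List; []; _∷_)
open import Data.List.Membership.Propositional using (_∈_)
import Data.List.Membership.DecPropositional as DecMembership
open import Data.List.Relation.Unary.All as All using (All)
open import Data.List.Relation.Unary.Any using (here; there)
open import Data.Nat using (ℕ; zero; suc; _+_)
open import Data.Product using (Σ; ∃; _×_; _,_; proj₁; proj₂)
import Data.Product.Properties as Product
open import Data.Sum using (_⊎_; inj₁; inj₂; map₁)
open import Data.Vec using ([]; _∷_; lookup; tabulate; reverse)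
open import Data.Vec.Properties using (lookup∘tabulate; lookup-replicate; ≡-dec)
open import Function using (_∘_; Injective; mk⇔)
open import Relation.Binary.PropositionalEquality
  using (_≡_; _≢_; refl; sym; trans; cong; cong₂; subst)
open import Relation.Nullary using (¬_; Dec; yes; no; ¬?; contradiction)
open import Relation.Nullary.Decidable
  using (_×-dec_; _⊎-dec_; map′; decidable-stable; dec-true; dec-false; does-⇔; from-yes)
open import Relation.Unary using (Decidable)

private
  variable
    k m n : ℕ

-- Induced paths on four vertices

module _ {G : Graph n} (simple : Simple G) where

  private
    true≢false : ∀ {b} → b ≡ true → b ≢ false
    true≢false refl ()

    G-sym = proj₁ simple
    G-irrefl = proj₂ simple

  adjacent⇒≢ : ∀ {x y} → G x y ≡ true → x ≢ y
  adjacent⇒≢ xy refl = true≢false xy (G-irrefl _)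

  -- Distinctness is automatic: consecutive vertices are adjacent, and if two others coincided, some
  -- pair would be both an edge and a non-edge.
  inducedP4 : ∀ {a b c d} → G a b ≡ true → G b c ≡ true → G c d ≡ true →
              G a c ≡ false → G a d ≡ false → G b d ≡ false → InducedP4 G
  inducedP4 {a} {b} {c} {d} ab bc cd ac ad bd = a , b , c , d ,
    (adjacent⇒≢ ab , (λ { refl → true≢false cd ad }) ,
     (λ { refl → true≢false cd (trans (G-sym _ _) ac) }) ,
     adjacent⇒≢ bc , (λ { refl → true≢false ab ad }) , adjacent⇒≢ cd) ,
    (ab , bc , cd) , (ac , ad , bd)

-- Contraction preserves being `P4Free`

contract-old : (G : Graph (suc m)) (u v : Fin (suc m)) {i j : Fin m} → i ≢ j →
               punchIn v i ≢ u → punchIn v j ≢ u →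
               contract G u v i j ≡ G (punchIn v i) (punchIn v j)
contract-old G u v {i} {j} i≢j i≢u j≢u
  rewrite dec-false (i ≟ j) i≢j
        | dec-false (punchIn v i ≟ u) i≢u
        | dec-false (punchIn v j ≟ u) j≢u = refl

contract-new : (G : Graph (suc m)) (u v : Fin (suc m)) {i j : Fin m} → i ≢ j →
               punchIn v i ≡ u →
               contract G u v i j ≡ G u (punchIn v j) ∨ G v (punchIn v j)
contract-new G u v {i} {j} i≢j i≡u
  rewrite dec-false (i ≟ j) i≢j
        | dec-true (punchIn v i ≟ u) i≡u = refl

contract-simple : {G : Graph (suc m)} → Simple G → ∀ u v → Simple (contract G u v)
contract-simple {G = G} (G-sym , _) u v = symmetric , irreflexive
  where
  symmetric : ∀ i j → contract G u v i j ≡ contract G u v j i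
  symmetric i j with i ≟ j
  ... | yes refl rewrite dec-true (i ≟ i) refl = refl
  ... | no i≢j rewrite dec-false (j ≟ i) (i≢j ∘ sym)
    with punchIn v i ≟ u | punchIn v j ≟ u
  ... | yes i≡u | yes j≡u = contradiction (punchIn-injective v i j (trans i≡u (sym j≡u))) i≢j
  ... | yes _   | no _    = refl
  ... | no _    | yes _   = refl
  ... | no _    | no _    = G-sym _ _

  irreflexive : ∀ i → contract G u v i i ≡ false
  irreflexive i rewrite dec-true (i ≟ i) refl = refl

-- An induced P₄ of G/uv through the new vertex lifts to G by replacing that vertex
-- with u, with v, or (if its two path neighbours need different ends) with the edge uv.
contract-P4Free : {G : Graph (suc m)} → Simple G → ∀ {u v} → G u v ≡ true →
                  P4Free G → P4Free (contract G u v)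
contract-P4Free {m} {G} simple@(G-sym , _) {u} {v} uv free (a , b , c , d , distinct , edges , non-edges) =
  lift distinct edges non-edges (p a ≟ u) (p b ≟ u) (p c ≟ u) (p d ≟ u)
  where
  C = contract G u v

  C-sym : ∀ i j {b} → C i j ≡ b → C j i ≡ b
  C-sym i j = trans (proj₁ (contract-simple simple u v) j i)

  p = punchIn v

  ∨-false : ∀ {x y} → x ∨ y ≡ false → x ≡ false × y ≡ false
  ∨-false {false} {false} _ = refl , refl

  old : ∀ {i j b} → C i j ≡ b → i ≢ j → p i ≢ u → p j ≢ u → G (p i) (p j) ≡ b
  old e i≢j i≢u j≢u = trans (sym (contract-old G u v i≢j i≢u j≢u)) e

  new : ∀ {i j b} → C i j ≡ b → i ≢ j → p i ≡ u → G u (p j) ∨ G v (p j) ≡ b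
  new e i≢j i≡u = trans (sym (contract-new G u v i≢j i≡u)) e

  replace-end : ∀ {b c d} → G u b ∨ G v b ≡ true → G u c ∨ G v c ≡ false → G u d ∨ G v d ≡ false →
                G b c ≡ true → G c d ≡ true → G b d ≡ false → InducedP4 G
  replace-end {b} wb wc wd bc cd bd with ∨-false wc | ∨-false wd | G u b in ub | wb
  ... | uc , vc | ud , vd | true  | _  = inducedP4 simple ub bc cd uc ud bd
  ... | uc , vc | ud , vd | false | vb = inducedP4 simple vb bc cd vc vd bd

  replace-middle : ∀ {a c d} → G u a ∨ G v a ≡ true → G u c ∨ G v c ≡ true → G u d ∨ G v d ≡ false →
                   G c d ≡ true → G a c ≡ false → G a d ≡ false → InducedP4 G
  replace-middle {a} {c} wa wc wd cd ac ad
    with ∨-false wd | G u a in ua | G v a in va | G u c in uc | G v c in vc | wa | wc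
  ... | ud , vd | true  | _     | true  | _     | _ | _ = inducedP4 simple (trans (G-sym _ _) ua) uc cd ac ad ud
  ... | ud , vd | _     | true  | _     | true  | _ | _ = inducedP4 simple (trans (G-sym _ _) va) vc cd ac ad vd
  -- Neither end of the edge sees both `a` and `c`, so the edge itself takes the place of the new
  -- vertex: the path is `a`, `u`, `v`, `c`, or `a`, `v`, `u`, `c` in the mirrored case, and `d` is
  -- dropped.
  ... | ud , vd | true  | false | false | true  | _ | _ =
    inducedP4 simple (trans (G-sym _ _) ua) uv vc (trans (G-sym _ _) va) ac uc
  ... | ud , vd | false | true  | true  | false | _ | _ =
    inducedP4 simple (trans (G-sym _ _) va) (trans (G-sym _ _) uv) uc (trans (G-sym _ _) ua) ac vc

  distinct-from-u : ∀ {i j} → i ≢ j → p i ≡ u → p j ≢ u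
  distinct-from-u i≢j i≡u j≡u = i≢j (punchIn-injective v _ _ (trans i≡u (sym j≡u)))

  lift-end : ∀ {a b c d} → a ≢ b → a ≢ c → a ≢ d → b ≢ c → b ≢ d → c ≢ d →
             C a b ≡ true → C b c ≡ true → C c d ≡ true → C a c ≡ false → C a d ≡ false → C b d ≡ false →
             p a ≡ u → InducedP4 G
  lift-end a≢b a≢c a≢d b≢c b≢d c≢d ab bc cd ac ad bd a≡u =
    replace-end (new ab a≢b a≡u) (new ac a≢c a≡u) (new ad a≢d a≡u)
      (old bc b≢c b≢u c≢u) (old cd c≢d c≢u d≢u) (old bd b≢d b≢u d≢u)
    where
    b≢u = distinct-from-u a≢b a≡u
    c≢u = distinct-from-u a≢c a≡u
    d≢u = distinct-from-u a≢d a≡u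

  lift-middle : ∀ {a b c d} → a ≢ b → a ≢ c → a ≢ d → b ≢ c → b ≢ d → c ≢ d →
                C a b ≡ true → C b c ≡ true → C c d ≡ true → C a c ≡ false → C a d ≡ false → C b d ≡ false →
                p b ≡ u → InducedP4 G
  lift-middle {a} {b} a≢b a≢c a≢d b≢c b≢d c≢d ab bc cd ac ad bd b≡u =
    replace-middle (new (C-sym a b ab) (a≢b ∘ sym) b≡u) (new bc b≢c b≡u) (new bd b≢d b≡u)
      (old cd c≢d c≢u d≢u) (old ac a≢c a≢u c≢u) (old ad a≢d a≢u d≢u)
    where
    a≢u = distinct-from-u (a≢b ∘ sym) b≡u
    c≢u = distinct-from-u b≢c b≡u
    d≢u = distinct-from-u b≢d b≡u

  lift : (a ≢ b × a ≢ c × a ≢ d × b ≢ c × b ≢ d × c ≢ d) →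
         (C a b ≡ true × C b c ≡ true × C c d ≡ true) →
         (C a c ≡ false × C a d ≡ false × C b d ≡ false) →
         Dec (p a ≡ u) → Dec (p b ≡ u) → Dec (p c ≡ u) → ¬ Dec (p d ≡ u)
  lift (a≢b , a≢c , a≢d , b≢c , b≢d , c≢d) (ab , bc , cd) (ac , ad , bd)
    (yes a≡u) _ _ _ = free (lift-end a≢b a≢c a≢d b≢c b≢d c≢d ab bc cd ac ad bd a≡u)
  lift (a≢b , a≢c , a≢d , b≢c , b≢d , c≢d) (ab , bc , cd) (ac , ad , bd)
    _ (yes b≡u) _ _ = free (lift-middle a≢b a≢c a≢d b≢c b≢d c≢d ab bc cd ac ad bd b≡u)
  -- With the new vertex in third or fourth place, the path is read backwards, which moves it to
  -- second or first place.
  lift (a≢b , a≢c , a≢d , b≢c , b≢d , c≢d) (ab , bc , cd) (ac , ad , bd)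
    _ _ (yes c≡u) _ = free (lift-middle
    (c≢d ∘ sym) (b≢d ∘ sym) (a≢d ∘ sym) (b≢c ∘ sym) (a≢c ∘ sym) (a≢b ∘ sym)
    (C-sym c d cd) (C-sym b c bc) (C-sym a b ab)
    (C-sym b d bd) (C-sym a d ad) (C-sym a c ac) c≡u)
  lift (a≢b , a≢c , a≢d , b≢c , b≢d , c≢d) (ab , bc , cd) (ac , ad , bd)
    _ _ _ (yes d≡u) = free (lift-end
    (c≢d ∘ sym) (b≢d ∘ sym) (a≢d ∘ sym) (b≢c ∘ sym) (a≢c ∘ sym) (a≢b ∘ sym)
    (C-sym c d cd) (C-sym b c bc) (C-sym a b ab)
    (C-sym b d bd) (C-sym a d ad) (C-sym a c ac) d≡u)
  lift (a≢b , a≢c , a≢d , b≢c , b≢d , c≢d) (ab , bc , cd) (ac , ad , bd)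
    (no a≢u) (no b≢u) (no c≢u) (no d≢u) = free (inducedP4 simple
    (old ab a≢b a≢u b≢u) (old bc b≢c b≢u c≢u) (old cd c≢d c≢u d≢u)
    (old ac a≢c a≢u c≢u) (old ad a≢d a≢u d≢u) (old bd b≢d b≢u d≢u))

-- Induced embeddings

infix 4 _↪_
record _↪_ (H : Graph k) (G : Graph n) : Set where
  field
    to        : Fin k → Fin n
    injective : Injective _≡_ _≡_ to
    adj       : ∀ i j → H i j ≡ G (to i) (to j)

open _↪_

InducedP4-↪ : {H : Graph k} {G : Graph n} → H ↪ G → InducedP4 H → InducedP4 G
InducedP4-↪ {H = H} {G} φ (a , b , c , d , (a≢b , a≢c , a≢d , b≢c , b≢d , c≢d) , (ab , bc , cd) , (ac , ad , bd)) =
  to φ a , to φ b , to φ c , to φ d ,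
  (a≢b ∘ injective φ , a≢c ∘ injective φ , a≢d ∘ injective φ ,
   b≢c ∘ injective φ , b≢d ∘ injective φ , c≢d ∘ injective φ) ,
  (carry a b ab , carry b c bc , carry c d cd) , (carry a c ac , carry a d ad , carry b d bd)
  where
  carry : ∀ i j {b} → H i j ≡ b → G (to φ i) (to φ j) ≡ b
  carry i j = trans (sym (adj φ i j))

-- Contraction commutes with passing to an induced subgraph containing `u` and `v`: inside the
-- subgraph, the neighbours of the new vertex depend only on the rows of `u` and `v` there. A bad
-- contraction of a small subgraph is therefore one of the whole graph.
contract-↪ : {H : Graph (suc k)} {G : Graph (suc n)} (φ : H ↪ G) → ∀ u v →
             contract H u v ↪ contract G (to φ u) (to φ v)
contract-↪ {k} {n} {H} {G} φ u v = record
  { to = f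
  ; injective = f-injective
  ; adj = f-adj
  }
  where
  avoids : ∀ i → to φ v ≢ to φ (punchIn v i)
  avoids i = punchInᵢ≢i v i ∘ sym ∘ injective φ

  f : Fin k → Fin n
  f i = punchOut (avoids i)

  f-injective : Injective _≡_ _≡_ f
  f-injective e = punchIn-injective v _ _ (injective φ (punchOut-injective (avoids _) (avoids _) e))

  f-adj : ∀ i j → contract H u v i j ≡ contract G (to φ u) (to φ v) (f i) (f j)
  f-adj i j
    -- By injectivity the three equality tests in `contract` give the same answer on both sides;
    -- `adj` then matches the remaining entries.
    rewrite punchIn-punchOut (avoids i)
          | punchIn-punchOut (avoids j)
          | does-⇔ (mk⇔ f-injective (cong f)) (f i ≟ f j) (i ≟ j)
          | does-⇔ (mk⇔ (injective φ) (cong (to φ))) (to φ (punchIn v i) ≟ to φ u) (punchIn v i ≟ u)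
          | does-⇔ (mk⇔ (injective φ) (cong (to φ))) (to φ (punchIn v j) ≟ to φ u) (punchIn v j ≟ u)
          | adj φ u (punchIn v j) | adj φ v (punchIn v j)
          | adj φ u (punchIn v i) | adj φ v (punchIn v i)
          | adj φ (punchIn v i) (punchIn v j) = refl

-- The failure of `AllContractionsP4Free` in positive form, so that a witness can be searched for in
-- a small graph and pushed along an embedding.
ContractsToP4 : Graph (suc n) → Set
ContractsToP4 G = ∃ λ u → ∃ λ v → G u v ≡ true × InducedP4 (contract G u v)

ContractsToP4-↪ : {H : Graph (suc k)} {G : Graph (suc n)} → H ↪ G → ContractsToP4 H → ContractsToP4 G
ContractsToP4-↪ φ (u , v , uv , path) =
  to φ u , to φ v , trans (sym (adj φ u v)) uv , InducedP4-↪ (contract-↪ φ u v) path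

extend : Graph k → (Fin k → Bool) → Graph (suc k)
extend H N zero    zero    = false
extend H N zero    (suc j) = N j
extend H N (suc i) zero    = N i
extend H N (suc i) (suc j) = H i j

extend-↪ : {H : Graph k} {G : Graph n} → Simple G → (φ : H ↪ G) (x : Fin n) → (∀ i → to φ i ≢ x) →
           {N : Fin k → Bool} → (∀ i → N i ≡ G x (to φ i)) → extend H N ↪ G
extend-↪ {k} {n} {H} {G} (G-sym , G-irrefl) φ x x∉φ {N} N≡ = record
  { to = f
  ; injective = λ {i} {j} → f-injective i j
  ; adj = f-adj
  }
  where
  f : Fin (suc k) → Fin n
  f zero    = x
  f (suc i) = to φ i

  f-injective : ∀ i j → f i ≡ f j → i ≡ j
  f-injective zero    zero    _ = refl
  f-injective zero    (suc j) e = contradiction (sym e) (x∉φ j)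
  f-injective (suc i) zero    e = contradiction e (x∉φ i)
  f-injective (suc i) (suc j) e = cong suc (injective φ e)

  f-adj : ∀ i j → extend H N i j ≡ G (f i) (f j)
  f-adj zero    zero    = sym (G-irrefl x)
  f-adj zero    (suc j) = N≡ j
  f-adj (suc i) zero    = trans (N≡ i) (G-sym _ _)
  f-adj (suc i) (suc j) = adj φ i j

path4 : Graph 4
path4 = sym-graph pathE

path4-↪ : {G : Graph n} → Simple G → InducedP4 G → path4 ↪ G
path4-↪ {n} {G} (G-sym , G-irrefl)
  (a , b , c , d , (a≢b , a≢c , a≢d , b≢c , b≢d , c≢d) , (ab , bc , cd) , (ac , ad , bd)) = record
  { to = f
  ; injective = λ {i} {j} → f-injective i j
  ; adj = f-adj
  }
  where
  f : Fin 4 → Fin n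
  f = lookup (a ∷ b ∷ c ∷ d ∷ [])

  f-injective : ∀ i j → f i ≡ f j → i ≡ j
  f-injective 0F 0F _ = refl
  f-injective 0F 1F e = contradiction e a≢b
  f-injective 0F 2F e = contradiction e a≢c
  f-injective 0F 3F e = contradiction e a≢d
  f-injective 1F 0F e = contradiction (sym e) a≢b
  f-injective 1F 1F _ = refl
  f-injective 1F 2F e = contradiction e b≢c
  f-injective 1F 3F e = contradiction e b≢d
  f-injective 2F 0F e = contradiction (sym e) a≢c
  f-injective 2F 1F e = contradiction (sym e) b≢c
  f-injective 2F 2F _ = refl
  f-injective 2F 3F e = contradiction e c≢d
  f-injective 3F 0F e = contradiction (sym e) a≢d
  f-injective 3F 1F e = contradiction (sym e) b≢d
  f-injective 3F 2F e = contradiction (sym e) c≢d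
  f-injective 3F 3F _ = refl

  f-adj : ∀ i j → path4 i j ≡ G (f i) (f j)
  f-adj 0F 0F = sym (G-irrefl a)
  f-adj 0F 1F = sym ab
  f-adj 0F 2F = sym ac
  f-adj 0F 3F = sym ad
  f-adj 1F 0F = sym (trans (G-sym b a) ab)
  f-adj 1F 1F = sym (G-irrefl b)
  f-adj 1F 2F = sym bc
  f-adj 1F 3F = sym bd
  f-adj 2F 0F = sym (trans (G-sym c a) ac)
  f-adj 2F 1F = sym (trans (G-sym c b) bc)
  f-adj 2F 2F = sym (G-irrefl c)
  f-adj 2F 3F = sym cd
  f-adj 3F 0F = sym (trans (G-sym d a) ad)
  f-adj 3F 1F = sym (trans (G-sym d b) bd)
  f-adj 3F 2F = sym (trans (G-sym d c) cd)
  f-adj 3F 3F = sym (G-irrefl d)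

-- Neighbourhoods on the path

InducedP4? : (G : Graph n) → Dec (InducedP4 G)
InducedP4? G = any? λ a → any? λ b → any? λ c → any? λ d →
  (¬? (a ≟ b) ×-dec ¬? (a ≟ c) ×-dec ¬? (a ≟ d) ×-dec ¬? (b ≟ c) ×-dec ¬? (b ≟ d) ×-dec ¬? (c ≟ d)) ×-dec
  ((G a b Bool.≟ true) ×-dec (G b c Bool.≟ true) ×-dec (G c d Bool.≟ true)) ×-dec
  ((G a c Bool.≟ false) ×-dec (G a d Bool.≟ false) ×-dec (G b d Bool.≟ false))

ContractsToP4? : (G : Graph (suc n)) → Dec (ContractsToP4 G)
ContractsToP4? G = any? λ u → any? λ v → (G u v Bool.≟ true) ×-dec InducedP4? (contract G u v)

allSubset? : {P : Subset n → Set} → Decidable P → Dec (∀ S → P S)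
allSubset? P? = map′ (λ ∄¬P S → decidable-stable (P? S) (∄¬P ∘ (S ,_))) (λ ∀P (S , ¬PS) → ¬PS (∀P S))
  (¬? (anySubset? (¬? ∘ P?)))

rt su ru rsu rtu rstu : Subset 4
rt   = inside  ∷ outside ∷ inside  ∷ outside ∷ []
su   = outside ∷ inside  ∷ outside ∷ inside  ∷ []
ru   = inside  ∷ outside ∷ outside ∷ inside  ∷ []
rsu  = inside  ∷ inside  ∷ outside ∷ inside  ∷ []
rtu  = inside  ∷ outside ∷ inside  ∷ inside  ∷ []
rstu = inside  ∷ inside  ∷ inside  ∷ inside  ∷ []

-- The nonempty sets S with no p ∈ S such that S ⊆ N[p]: given such a p, contracting the
-- edge from p to a vertex attached to S would keep the path induced.
admissible : List (Subset 4)
admissible = rt ∷ su ∷ ru ∷ rsu ∷ rtu ∷ rstu ∷ []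

-- The pairs are ordered, so `rsu` with `rtu` is listed both ways round.
compatible : List (Subset 4 × Subset 4)
compatible = (rt , rt) ∷ (su , su) ∷ (rsu , rtu) ∷ (rtu , rsu) ∷ (rstu , rstu) ∷ []

private
  _≟S_ : (S T : Subset 4) → Dec (S ≡ T)
  _≟S_ = ≡-dec Bool._≟_

  open DecMembership _≟S_ using (_∈?_)
  open DecMembership (Product.≡-dec _≟S_ _≟S_) using () renaming (_∈?_ to _∈²?_)

-- Index 0 is the vertex attached to `S`, index 1 the one attached to `T`, and the path follows. The
-- leading `outside` makes the two extra vertices nonadjacent.
twoApart : Subset 4 → Subset 4 → Graph 6
twoApart S T = extend (extend path4 (lookup T)) (lookup (outside ∷ S))

-- Abstract, since unfolding these searches during later unification exhausts memory.
abstract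

  attachment : ∀ S → S ≡ ∅ ⊎ S ∈ admissible ⊎ ContractsToP4 (extend path4 (lookup S))
  attachment = from-yes (allSubset? λ S →
    (S ≟S ∅) ⊎-dec (S ∈? admissible) ⊎-dec ContractsToP4? (extend path4 (lookup S)))

  -- Nonadjacent pairs suffice, since the vertices outside the path turn out to be independent. Of
  -- the 36 ordered pairs of admissible sets, the 31 outside `compatible` have a bad contraction.
  attachments : All (λ S → All (λ T → (S , T) ∈ compatible ⊎ ContractsToP4 (twoApart S T)) admissible) admissible
  attachments = from-yes (All.all? (λ S → All.all? (λ T →
    ((S , T) ∈²? compatible) ⊎-dec ContractsToP4? (twoApart S T)) admissible) admissible)

-- Isomorphism types

≅-trans : ∀ {l} (F : Graph l) (G : Graph m) (H : Graph n) → F ≅ G → G ≅ H → F ≅ H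
≅-trans F G H (π , π-adj) (ρ , ρ-adj) =
  π ∘ₚ ρ , λ i j → trans (π-adj i j) (ρ-adj (π ⟨$⟩ʳ i) (π ⟨$⟩ʳ j))

NotExceptional-≅ : (G : Graph m) (H : Graph n) → G ≅ H → NotExceptional G → NotExceptional H
NotExceptional-≅ G H G≅H (¬ex1 , ¬ex2 , ¬ex3 , ¬ex4 , ¬ex5) =
  ¬ex1 ∘ ≅-trans G H ex1 G≅H , ¬ex2 ∘ ≅-trans G H ex2 G≅H , ¬ex3 ∘ ≅-trans G H ex3 G≅H ,
  (λ k → ¬ex4 k ∘ ≅-trans G H (ex4 k) G≅H) , (λ k → ¬ex5 k ∘ ≅-trans G H (ex5 k) G≅H)

-- Normal form of a graph whose vertices outside the path are independent: only the neighbourhoods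
-- `τ x` on the path remain as data. The sum type makes each block of the adjacency matrix a
-- separate case.
attachedAdj : (Fin m → Subset 4) → Fin 4 ⊎ Fin m → Fin 4 ⊎ Fin m → Bool
attachedAdj τ (inj₁ i) (inj₁ j) = path4 i j
attachedAdj τ (inj₁ i) (inj₂ y) = lookup (τ y) i
attachedAdj τ (inj₂ x) (inj₁ j) = lookup (τ x) j
attachedAdj τ (inj₂ x) (inj₂ y) = false

attached : (Fin m → Subset 4) → Graph (4 + m)
attached τ i j = attachedAdj τ (splitAt 4 i) (splitAt 4 j)

-- The identity is the isomorphism, as both graphs number the path first; it remains to compare
-- blocks. The mixed block is compared in both orders because `H` is an arbitrary Boolean matrix.
attached-≅ : {τ : Fin m → Subset 4} (σ : Fin m → Subset 4) (H : Graph (4 + m)) → (∀ x → τ x ≡ σ x) →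
             (∀ i j → H (i ↑ˡ m) (j ↑ˡ m) ≡ path4 i j) →
             (∀ x j → H (4 ↑ʳ x) (j ↑ˡ m) ≡ lookup (σ x) j × H (j ↑ˡ m) (4 ↑ʳ x) ≡ lookup (σ x) j) →
             (∀ x y → H (4 ↑ʳ x) (4 ↑ʳ y) ≡ false) →
             attached τ ≅ H
attached-≅ {m} {τ} σ H τ≗σ on-path across off-path = Perm.id , λ i j →
  trans (agree (splitAt 4 i) (splitAt 4 j)) (cong₂ H (join-splitAt 4 m i) (join-splitAt 4 m j))
  where
  agree : ∀ p q → attachedAdj τ p q ≡ H (join 4 m p) (join 4 m q)
  agree (inj₁ i) (inj₁ j) = sym (on-path i j)
  agree (inj₁ i) (inj₂ y) = trans (cong (λ S → lookup S i) (τ≗σ y)) (sym (proj₂ (across y i)))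
  agree (inj₂ x) (inj₁ j) = trans (cong (λ S → lookup S j) (τ≗σ x)) (sym (proj₁ (across x j)))
  agree (inj₂ x) (inj₂ y) = sym (off-path x y)

-- Reversing the path is an automorphism of it. It exchanges `rt` with `su` and `rsu` with `rtu`, so
-- `su` and `rtu` need no exceptional graphs of their own.
attached-reverse : (τ : Fin m → Subset 4) → attached τ ≅ attached (reverse ∘ τ)
attached-reverse {m} τ = ρ , λ i j →
  trans (flip-adj (splitAt 4 i) (splitAt 4 j))
        (sym (cong₂ (attachedAdj (reverse ∘ τ)) (splitAt-ρ i) (splitAt-ρ j)))
  where
  ρ : Permutation (4 + m) (4 + m)
  -- Swaps `r` with `u` and `s` with `t`, and fixes every outside vertex.
  ρ = transpose 0F 3F ∘ₚ transpose 1F 2F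

  splitAt-ρ : ∀ i → splitAt 4 (ρ ⟨$⟩ʳ i) ≡ map₁ opposite (splitAt 4 i)
  splitAt-ρ 0F = refl
  splitAt-ρ 1F = refl
  splitAt-ρ 2F = refl
  splitAt-ρ 3F = refl
  splitAt-ρ (suc (suc (suc (suc i)))) = refl

  path4-opposite : ∀ i j → path4 i j ≡ path4 (opposite i) (opposite j)
  path4-opposite = from-yes (all? λ i → all? λ j → path4 i j Bool.≟ path4 (opposite i) (opposite j))

  lookup-reverse : (S : Subset 4) (i : Fin 4) → lookup S i ≡ lookup (reverse S) (opposite i)
  lookup-reverse (_ ∷ _ ∷ _ ∷ _ ∷ []) 0F = refl
  lookup-reverse (_ ∷ _ ∷ _ ∷ _ ∷ []) 1F = refl
  lookup-reverse (_ ∷ _ ∷ _ ∷ _ ∷ []) 2F = refl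
  lookup-reverse (_ ∷ _ ∷ _ ∷ _ ∷ []) 3F = refl

  flip-adj : ∀ p q → attachedAdj τ p q ≡ attachedAdj (reverse ∘ τ) (map₁ opposite p) (map₁ opposite q)
  flip-adj (inj₁ i) (inj₁ j) = path4-opposite i j
  flip-adj (inj₁ i) (inj₂ y) = lookup-reverse (τ y) i
  flip-adj (inj₂ x) (inj₁ j) = lookup-reverse (τ x) j
  flip-adj (inj₂ x) (inj₂ y) = refl

-- Recognising the exceptional graphs

attached-rt : (τ : Fin m → Subset 4) → (∀ x → τ x ≡ rt) → attached τ ≅ ex4 m
attached-rt {m} τ τ≡ = attached-≅ (λ _ → rt) (ex4 m) τ≡
  -- The decisions evaluate although `m` is a variable: path vertices have literal indices, and an
  -- outside vertex has an index of the form `4 + _`, which settles every comparison in `ex4`.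
  (from-yes (all? λ i → all? λ j → ex4 m (i ↑ˡ m) (j ↑ˡ m) Bool.≟ path4 i j))
  (λ x → from-yes (all? λ j →
    (ex4 m (4 ↑ʳ x) (j ↑ˡ m) Bool.≟ lookup rt j) ×-dec (ex4 m (j ↑ˡ m) (4 ↑ʳ x) Bool.≟ lookup rt j)))
  (λ x y → refl)

attached-rstu : (τ : Fin m → Subset 4) → (∀ x → τ x ≡ rstu) → attached τ ≅ ex5 m
attached-rstu {m} τ τ≡ = attached-≅ (λ _ → rstu) (ex5 m) τ≡
  (from-yes (all? λ i → all? λ j → ex5 m (i ↑ˡ m) (j ↑ˡ m) Bool.≟ path4 i j))
  (λ x → from-yes (all? λ j →
    (ex5 m (4 ↑ʳ x) (j ↑ˡ m) Bool.≟ lookup rstu j) ×-dec (ex5 m (j ↑ˡ m) (4 ↑ʳ x) Bool.≟ lookup rstu j)))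
  (λ x y → refl)

attached-ru : (τ : Fin 1 → Subset 4) → τ 0F ≡ ru → attached τ ≅ ex1
attached-ru τ τ₀≡ = attached-≅ σ ex1 (λ { 0F → τ₀≡ })
  (from-yes (all? λ i → all? λ j → ex1 (i ↑ˡ 1) (j ↑ˡ 1) Bool.≟ path4 i j))
  (from-yes (all? λ x → all? λ j →
    (ex1 (4 ↑ʳ x) (j ↑ˡ 1) Bool.≟ lookup (σ x) j) ×-dec (ex1 (j ↑ˡ 1) (4 ↑ʳ x) Bool.≟ lookup (σ x) j)))
  (from-yes (all? λ x → all? λ y → ex1 (4 ↑ʳ x) (4 ↑ʳ y) Bool.≟ false))
  where
  σ : Fin 1 → Subset 4
  σ = lookup (ru ∷ [])

attached-rsu : (τ : Fin 1 → Subset 4) → τ 0F ≡ rsu → attached τ ≅ ex2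
attached-rsu τ τ₀≡ = attached-≅ σ ex2 (λ { 0F → τ₀≡ })
  (from-yes (all? λ i → all? λ j → ex2 (i ↑ˡ 1) (j ↑ˡ 1) Bool.≟ path4 i j))
  (from-yes (all? λ x → all? λ j →
    (ex2 (4 ↑ʳ x) (j ↑ˡ 1) Bool.≟ lookup (σ x) j) ×-dec (ex2 (j ↑ˡ 1) (4 ↑ʳ x) Bool.≟ lookup (σ x) j)))
  (from-yes (all? λ x → all? λ y → ex2 (4 ↑ʳ x) (4 ↑ʳ y) Bool.≟ false))
  where
  σ : Fin 1 → Subset 4
  σ = lookup (rsu ∷ [])

attached-rsu-rtu : (τ : Fin 2 → Subset 4) → τ 0F ≡ rsu → τ 1F ≡ rtu → attached τ ≅ ex3
attached-rsu-rtu τ τ₀≡ τ₁≡ = attached-≅ σ ex3 (λ { 0F → τ₀≡ ; 1F → τ₁≡ })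
  (from-yes (all? λ i → all? λ j → ex3 (i ↑ˡ 2) (j ↑ˡ 2) Bool.≟ path4 i j))
  (from-yes (all? λ x → all? λ j →
    (ex3 (4 ↑ʳ x) (j ↑ˡ 2) Bool.≟ lookup (σ x) j) ×-dec (ex3 (j ↑ˡ 2) (4 ↑ʳ x) Bool.≟ lookup (σ x) j)))
  (from-yes (all? λ x → all? λ y → ex3 (4 ↑ʳ x) (4 ↑ʳ y) Bool.≟ false))
  where
  σ : Fin 2 → Subset 4
  σ = lookup (rsu ∷ rtu ∷ [])

-- Pairwise compatible attachments

Compatible : Subset 4 → Subset 4 → Set
Compatible S T = (S , T) ∈ compatible

rt-partner : ∀ {T} → Compatible rt T → T ≡ rt
rt-partner (here refl) = refl
rt-partner (there (there (there (there (there ())))))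

su-partner : ∀ {T} → Compatible su T → T ≡ su
su-partner (there (here refl)) = refl
su-partner (there (there (there (there (there ())))))

rstu-partner : ∀ {T} → Compatible rstu T → T ≡ rstu
rstu-partner (there (there (there (there (here refl))))) = refl
rstu-partner (there (there (there (there (there ())))))

rsu-partner : ∀ {T} → Compatible rsu T → T ≡ rtu
rsu-partner (there (there (here refl))) = refl
rsu-partner (there (there (there (there (there ())))))

rtu-partner : ∀ {T} → Compatible rtu T → T ≡ rsu
rtu-partner (there (there (there (here refl)))) = refl
rtu-partner (there (there (there (there (there ())))))

ru-partner : ∀ {T} → ¬ Compatible ru T
ru-partner (there (there (there (there (there ())))))

compatible-reverse : ∀ {S T} → Compatible S T → Compatible (reverse S) (reverse T)
compatible-reverse (here refl) = there (here refl)
compatible-reverse (there (here refl)) = here refl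
compatible-reverse (there (there (here refl))) = there (there (there (here refl)))
compatible-reverse (there (there (there (here refl)))) = there (there (here refl))
compatible-reverse (there (there (there (there (here refl))))) = there (there (there (there (here refl))))

PairwiseCompatible : (Fin m → Subset 4) → Set
PairwiseCompatible τ = ∀ x y → x ≢ y → Compatible (τ x) (τ y)

compatible-with : {τ : Fin m → Subset 4} {S : Subset 4} → PairwiseCompatible τ →
                  ∀ x y → x ≢ y → τ x ≡ S → Compatible S (τ y)
compatible-with comp x y x≢y τx≡ = subst (λ S → Compatible S _) τx≡ (comp x y x≢y)

constant : (τ : Fin (suc m) → Subset 4) {S : Subset 4} → PairwiseCompatible τ → τ 0F ≡ S →
           (∀ {T} → Compatible S T → T ≡ S) → ∀ x → τ x ≡ S
constant τ comp τ₀≡ partner zero    = τ₀≡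
constant τ comp τ₀≡ partner (suc y) = partner (compatible-with comp 0F (suc y) (λ ()) τ₀≡)

-- No second outside vertex can accompany one attached to `ru`, so the graph is the 5-cycle.
ru-exceptional : (τ : Fin (suc m) → Subset 4) → PairwiseCompatible τ → τ 0F ≡ ru → ¬ NotExceptional (attached τ)
ru-exceptional {zero}  τ comp τ₀≡ (¬ex1 , _) = ¬ex1 (attached-ru τ τ₀≡)
ru-exceptional {suc m} τ comp τ₀≡ _ = ru-partner (compatible-with comp 0F 1F (λ ()) τ₀≡)

-- There are at most two outside vertices: beside one at `rsu` and one at `rtu`, a third would have
-- to be attached to `rtu` and to `rsu` at once.
rsu-exceptional : (τ : Fin (suc m) → Subset 4) → PairwiseCompatible τ → τ 0F ≡ rsu → ¬ NotExceptional (attached τ)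
rsu-exceptional {zero} τ comp τ₀≡ (_ , ¬ex2 , _) = ¬ex2 (attached-rsu τ τ₀≡)
rsu-exceptional {suc m} τ comp τ₀≡ = two-or-more m τ comp τ₀≡ (rsu-partner (compatible-with comp 0F 1F (λ ()) τ₀≡))
  where
  two-or-more : ∀ m (τ : Fin (2 + m) → Subset 4) → PairwiseCompatible τ → τ 0F ≡ rsu → τ 1F ≡ rtu →
                ¬ NotExceptional (attached τ)
  two-or-more zero    τ comp τ₀≡ τ₁≡ (_ , _ , ¬ex3 , _) = ¬ex3 (attached-rsu-rtu τ τ₀≡ τ₁≡)
  two-or-more (suc m) τ comp τ₀≡ τ₁≡ _
    with () ← trans (sym (rsu-partner (compatible-with comp 0F 2F (λ ()) τ₀≡)))
                    (rtu-partner (compatible-with comp 1F 2F (λ ()) τ₁≡))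

attached-exceptional : (τ : Fin m → Subset 4) → (∀ x → τ x ∈ admissible) → PairwiseCompatible τ →
                       ¬ NotExceptional (attached τ)
-- With no outside vertex the graph is the path itself, the case `k = 0` of `ex4`.
attached-exceptional {zero} τ _ _ (_ , _ , _ , ¬ex4 , _) = ¬ex4 0 (attached-rt τ λ ())
attached-exceptional {suc m} τ adm comp ne@(_ , _ , _ , ¬ex4 , ¬ex5) = by-first (adm 0F)
  where
  by-first : ¬ (τ 0F ∈ admissible)
  by-first (here e) = ¬ex4 _ (attached-rt τ (constant τ comp e rt-partner))
  by-first (there (here e)) = ¬ex4 _ (≅-trans (attached τ) (attached (reverse ∘ τ)) (ex4 _) (attached-reverse τ)
    (attached-rt (reverse ∘ τ) (λ x → cong reverse (constant τ comp e su-partner x))))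
  by-first (there (there (here e))) = ru-exceptional τ comp e ne
  by-first (there (there (there (here e)))) = rsu-exceptional τ comp e ne
  -- Reversing the path turns `rtu` into `rsu`; compatibility and non-exceptionality are carried
  -- along.
  by-first (there (there (there (there (here e))))) =
    rsu-exceptional (reverse ∘ τ) (λ x y → compatible-reverse ∘ comp x y) (cong reverse e)
      (NotExceptional-≅ (attached τ) (attached (reverse ∘ τ)) (attached-reverse τ) ne)
  by-first (there (there (there (there (there (here e)))))) = ¬ex5 _ (attached-rstu τ (constant τ comp e rstu-partner))

-- Reduction to the normal form

-- Used to renumber a graph so that an induced path comes first, with `m` counting the other
-- vertices. By induction on `k`: remove `f 0F` from the codomain, extend the rest, and insert
-- `f 0F` again.
extend-to-permutation : (f : Fin k → Fin n) → Injective _≡_ _≡_ f →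
                        ∃ λ m → Σ (Permutation (k + m) n) λ π → ∀ i → π ⟨$⟩ʳ (i ↑ˡ m) ≡ f i
extend-to-permutation {zero}  {n}     f f-injective = n , Perm.id , λ ()
extend-to-permutation {suc k} {zero}  f f-injective with () ← f 0F
extend-to-permutation {suc k} {suc n} f f-injective =
  let m , π , π-extends = extend-to-permutation f′ f′-injective in
  m , insert 0F (f 0F) π , λ where
    zero    → refl
    (suc i) → trans (cong (punchIn (f 0F)) (π-extends i)) (punchIn-punchOut (avoids i))
  where
  avoids : ∀ i → f 0F ≢ f (suc i)
  avoids i e with () ← f-injective e

  f′ : Fin k → Fin n
  f′ i = punchOut (avoids i)

  f′-injective : Injective _≡_ _≡_ f′
  f′-injective = suc-injective ∘ f-injective ∘ punchOut-injective (avoids _) (avoids _)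

exceptional : {G : Graph (suc n)} → Simple G → NoIsolatedVertices G → ¬ ContractsToP4 G →
              InducedP4 G → ¬ NotExceptional G
exceptional {n} {G} simple@(G-sym , G-irrefl) no-isolated no-contraction path ne
  with extend-to-permutation (to (path4-↪ simple path)) (injective (path4-↪ simple path))
... | m , π , π-extends =
  attached-exceptional τ τ-admissible τ-compatible (NotExceptional-≅ G (attached τ) G≅attached ne)
  where
  φ = path4-↪ simple path

  out : Fin m → Fin (suc n)
  out x = π ⟨$⟩ʳ (4 ↑ʳ x)

  π-injective : ∀ {i j} → π ⟨$⟩ʳ i ≡ π ⟨$⟩ʳ j → i ≡ j
  π-injective e = trans (sym (inverseˡ π)) (trans (cong (π ⟨$⟩ˡ_) e) (inverseˡ π))

  restore : ∀ v → π ⟨$⟩ʳ join 4 m (splitAt 4 (π ⟨$⟩ˡ v)) ≡ v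
  restore v = trans (cong (π ⟨$⟩ʳ_) (join-splitAt 4 m _)) (inverseʳ π)

  out-injective : ∀ {x y} → out x ≡ out y → x ≡ y
  out-injective = ↑ʳ-injective 4 _ _ ∘ π-injective

  out∉φ : ∀ x i → to φ i ≢ out x
  out∉φ x i e
    -- Path and outside vertices land on different sides of `splitAt 4`.
    with () ← trans (sym (splitAt-↑ˡ 4 i m))
                (trans (cong (splitAt 4) (π-injective (trans (π-extends i) e))) (splitAt-↑ʳ 4 m x))

  N : Fin (suc n) → Subset 4
  N v = tabulate (λ i → G v (to φ i))

  lookup-N : ∀ v i → lookup (N v) i ≡ G v (to φ i)
  lookup-N v = lookup∘tabulate _

  τ : Fin m → Subset 4
  τ x = N (out x)

  one-↪ : ∀ x → extend path4 (lookup (τ x)) ↪ G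
  one-↪ x = extend-↪ simple φ (out x) (out∉φ x) (lookup-N (out x))

  -- The head bit `b` records whether the two outside vertices are adjacent: `true` serves the
  -- independence proof, `false` gives `twoApart`.
  two-↪ : ∀ {x y b} → x ≢ y → G (out x) (out y) ≡ b →
          extend (extend path4 (lookup (τ y))) (lookup (b ∷ τ x)) ↪ G
  two-↪ {x} {y} x≢y xy = extend-↪ simple (one-↪ y) (out x)
    (λ { zero → x≢y ∘ sym ∘ out-injective ; (suc i) → out∉φ x i })
    (λ { zero → sym xy ; (suc i) → lookup-N (out x) i })

  outside-independent : ∀ x y → G (out x) (out y) ≡ false
  outside-independent x y with x ≟ y
  ... | yes refl = G-irrefl _
  ... | no x≢y with G (out x) (out y) in xy
  ...   | false = refl
  ...   | true  = contradiction (ContractsToP4-↪ (two-↪ x≢y xy) (0F , 1F , refl , path-survives)) no-contraction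
    where
    -- Contracting the edge between indices 0 and 1 deletes index 1, which shifts the untouched path
    -- from indices 2 to 5 down to 1 to 4.
    path-survives = 1F , 2F , 3F , 4F ,
      ((λ ()) , (λ ()) , (λ ()) , (λ ()) , (λ ()) , (λ ())) , (refl , refl , refl) , (refl , refl , refl)

  -- Here `no-isolated` enters: `out x` has a neighbour, and by independence that neighbour lies on
  -- the path.
  τ-nonempty : ∀ x → τ x ≢ ∅
  τ-nonempty x τ≡∅ = no-neighbour (splitAt 4 (π ⟨$⟩ˡ v)) (subst (λ w → G (out x) w ≡ true) (sym (restore v)) xv)
    where
    v = proj₁ (no-isolated (out x))
    xv = proj₂ (no-isolated (out x))

    no-neighbour : ∀ p → G (out x) (π ⟨$⟩ʳ join 4 m p) ≢ true
    no-neighbour (inj₁ i) e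
      with () ← trans (sym e) (trans (cong (G (out x)) (π-extends i)) (trans (sym (lookup-N (out x) i))
                  (trans (cong (λ S → lookup S i) τ≡∅) (lookup-replicate i false))))
    no-neighbour (inj₂ y) e with () ← trans (sym e) (outside-independent x y)

  τ-admissible : ∀ x → τ x ∈ admissible
  τ-admissible x with attachment (τ x)
  ... | inj₁ τ≡∅       = contradiction τ≡∅ (τ-nonempty x)
  ... | inj₂ (inj₁ τ∈) = τ∈
  ... | inj₂ (inj₂ c)  = contradiction (ContractsToP4-↪ (one-↪ x) c) no-contraction

  τ-compatible : PairwiseCompatible τ
  τ-compatible x y x≢y with All.lookup (All.lookup attachments (τ-admissible x)) (τ-admissible y)
  ... | inj₁ xy = xy
  ... | inj₂ c  = contradiction (ContractsToP4-↪ (two-↪ x≢y (outside-independent x y)) c) no-contraction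

  G≡attached : ∀ p q → G (π ⟨$⟩ʳ join 4 m p) (π ⟨$⟩ʳ join 4 m q) ≡ attachedAdj τ p q
  G≡attached (inj₁ i) (inj₁ j) = trans (cong₂ G (π-extends i) (π-extends j)) (sym (adj φ i j))
  G≡attached (inj₁ i) (inj₂ y) = trans (G-sym _ _) (trans (cong (G (out y)) (π-extends i)) (sym (lookup-N (out y) i)))
  G≡attached (inj₂ x) (inj₁ j) = trans (cong (G (out x)) (π-extends j)) (sym (lookup-N (out x) j))
  G≡attached (inj₂ x) (inj₂ y) = outside-independent x y

  G≅attached : G ≅ attached τ
  -- `π` leads from the normal form to `G`, so its inverse is the isomorphism wanted.
  G≅attached = Perm.flip π , λ v w → trans (sym (cong₂ G (restore v) (restore w)))
    (G≡attached (splitAt 4 (π ⟨$⟩ˡ v)) (splitAt 4 (π ⟨$⟩ˡ w)))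

theorem28 : (n : ℕ) (G : Graph n) → Simple G → NoIsolatedVertices G → NotExceptional G →
    (P4Free G → AllContractionsP4Free G) × (AllContractionsP4Free G → P4Free G)
-- On no vertices the contraction condition is trivial, and an induced path would need an element of
-- `Fin 0`.
theorem28 zero    G simple no-isolated ne = _ , λ { _ (() , _) }
theorem28 (suc m) G simple no-isolated ne =
  (λ free u v uv → contract-P4Free simple uv free) ,
  (λ free path → exceptional simple no-isolated (λ (u , v , uv , c) → free u v uv c) path ne)
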